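{- Let $m\ge 1$, $T\subseteq\{0,\ldots,m-1\}$, $\Delta_t=m-t$ for $t\in T$, and let $U=\sum_{t\in T}N^{\Delta_t}$ as a linear operator on $\mathbb{F}_2^m$. Then for every integer $k\ge 0$, $$U^{2^k}=\sum_{t\in T}N^{2^k\Delta_t},$$ where shifts by at least $m$ are zero.
   Context: For $d\ge 0$, $N^d$ is the truncated right shift on $\mathbb{F}_2^m$: for $y=(y_0,\ldots,y_{m-1})$, $(N^dy)_i=y_{i+d}$ if $0\le i<m-d$ and $(N^dy)_i=0$ if $m-d\le i<m$; $N^d=0$ for $d\ge m$. Empty sums denote the zero map. -}

module Defs where

open import Algebra.Bundles using (RawSemiring)
open import Algebra.Module.Bundles using (LeftModule)
import Algebra.Definitions.RawSemiring as RawSemiringDefinitions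
import Algebra.Module.Morphism.Construct.Composition as Composition
import Algebra.Module.Morphism.Construct.Identity as Identity
open import Algebra.Module.Morphism.Structures using (module LeftModuleMorphisms)
open import Data.Bool.Base using (if_then_else_)
open import Data.Fin.Base using (Fin; toℕ; fromℕ<)
open import Data.Fin.Subset using (Subset)
open import Data.Fin.Subset.Properties using (_∈?_)
open import Data.Nat.Base using (ℕ; _∸_; _<_)
import Data.Nat.Base as ℕ
open import Data.Nat.Properties using (_<?_)
open import Data.Parity.Base using (Parity; 0ℙ; 1ℙ; _+_; _*_)
import Data.Parity.Properties as ℙ
open import Data.Product.Base using (_,_)
open import Data.Vec.Base using (Vec; []; _∷_; lookup; map; replicate; tabulate; zipWith)
open import Data.Vec.Properties
open import Function.Base using (id; _∘_)
open import Level using (0ℓ)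
open import Relation.Binary.PropositionalEquality
open import Relation.Nullary.Decidable using (Dec; yes; no; does)

-- The field 𝔽₂ is the ring `ℙ.+-*-ring` of parities, in which negation
-- is the identity.

𝔽₂^ : ℕ → Set
𝔽₂^ m = Vec Parity m

private
  variable
    m : ℕ

infixl 6 _⊕_
infixr 7 _⊙_

_⊕_ : 𝔽₂^ m → 𝔽₂^ m → 𝔽₂^ m
_⊕_ = zipWith _+_

_⊙_ : Parity → 𝔽₂^ m → 𝔽₂^ m
a ⊙ x = map (a *_) x

𝟎 : 𝔽₂^ m
𝟎 = replicate _ 0ℙ

⊕-self : (x : 𝔽₂^ m) → x ⊕ x ≡ 𝟎
⊕-self []      = refl
⊕-self (a ∷ x) = cong₂ _∷_ (ℙ.p+p≡0ℙ a) (⊕-self x)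

⊙-zeroˡ : (x : 𝔽₂^ m) → 0ℙ ⊙ x ≡ 𝟎
⊙-zeroˡ x = map-const x 0ℙ

⊙-zeroʳ : (a : Parity) → a ⊙ 𝟎 {m} ≡ 𝟎
⊙-zeroʳ {m} a = trans (map-replicate (a *_) 0ℙ m) (cong (replicate m) (ℙ.*-zeroʳ a))

⊙-distribˡ : (a : Parity) (x y : 𝔽₂^ m) → a ⊙ (x ⊕ y) ≡ a ⊙ x ⊕ a ⊙ y
⊙-distribˡ a []      []      = refl
⊙-distribˡ a (b ∷ x) (c ∷ y) = cong₂ _∷_ (ℙ.*-distribˡ-+ a b c) (⊙-distribˡ a x y)

⊙-distribʳ : (x : 𝔽₂^ m) (a b : Parity) → (a + b) ⊙ x ≡ a ⊙ x ⊕ b ⊙ x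
⊙-distribʳ []      a b = refl
⊙-distribʳ (c ∷ x) a b = cong₂ _∷_ (ℙ.*-distribʳ-+ c a b) (⊙-distribʳ x a b)

⊙-assoc : (a b : Parity) (x : 𝔽₂^ m) → (a * b) ⊙ x ≡ a ⊙ (b ⊙ x)
⊙-assoc a b x = trans (map-cong (ℙ.*-assoc a b) x) (map-∘ (a *_) (b *_) x)

⊕-comm : (x y : 𝔽₂^ m) → x ⊕ y ≡ y ⊕ x
⊕-comm = zipWith-comm ℙ.+-comm

⊕-assoc : (x y z : 𝔽₂^ m) → (x ⊕ y) ⊕ z ≡ x ⊕ (y ⊕ z)
⊕-assoc = zipWith-assoc ℙ.+-assoc

⊕-interchange : (w x y z : 𝔽₂^ m) → (w ⊕ x) ⊕ (y ⊕ z) ≡ (w ⊕ y) ⊕ (x ⊕ z)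
⊕-interchange w x y z = begin
  (w ⊕ x) ⊕ (y ⊕ z)  ≡⟨ ⊕-assoc w x (y ⊕ z) ⟩
  w ⊕ (x ⊕ (y ⊕ z))  ≡⟨ cong (w ⊕_) (⊕-assoc x y z) ⟨
  w ⊕ ((x ⊕ y) ⊕ z)  ≡⟨ cong (λ v → w ⊕ (v ⊕ z)) (⊕-comm x y) ⟩
  w ⊕ ((y ⊕ x) ⊕ z)  ≡⟨ cong (w ⊕_) (⊕-assoc y x z) ⟩
  w ⊕ (y ⊕ (x ⊕ z))  ≡⟨ ⊕-assoc w y (x ⊕ z) ⟨
  (w ⊕ y) ⊕ (x ⊕ z)  ∎
  where open ≡-Reasoning

𝔽₂^-leftModule : ℕ → LeftModule ℙ.+-*-ring 0ℓ 0ℓ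
𝔽₂^-leftModule m = record
  { Carrierᴹ = 𝔽₂^ m
  ; _≈ᴹ_ = _≡_
  ; _+ᴹ_ = _⊕_
  ; _*ₗ_ = _⊙_
  ; 0ᴹ = 𝟎
  ; -ᴹ_ = id
  ; isLeftModule = record
    { isLeftSemimodule = record
      { +ᴹ-isCommutativeMonoid = record
        { isMonoid = record
          { isSemigroup = record
            { isMagma = record { isEquivalence = isEquivalence ; ∙-cong = cong₂ _⊕_ }
            ; assoc = ⊕-assoc
            }
          ; identity = zipWith-identityˡ ℙ.+-identityˡ , zipWith-identityʳ ℙ.+-identityʳ
          }
        ; comm = ⊕-comm
        }
      ; isPreleftSemimodule = record
        { *ₗ-cong = cong₂ _⊙_
        ; *ₗ-zeroˡ = ⊙-zeroˡ
        ; *ₗ-distribʳ = ⊙-distribʳ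
        ; *ₗ-identityˡ = map-id
        ; *ₗ-assoc = ⊙-assoc
        ; *ₗ-zeroʳ = ⊙-zeroʳ
        ; *ₗ-distribˡ = ⊙-distribˡ
        }
      }
    ; -ᴹ‿cong = id
    ; -ᴹ‿inverse = ⊕-self , ⊕-self
    }
  }

IsLinear : (𝔽₂^ m → 𝔽₂^ m) → Set
IsLinear {m} = IsLeftModuleHomomorphism
  where
  V = LeftModule.rawLeftModule (𝔽₂^-leftModule m)
  open LeftModuleMorphisms V V

record LinearOperator (m : ℕ) : Set where
  constructor _,_
  field
    ⟦_⟧      : 𝔽₂^ m → 𝔽₂^ m
    isLinear : IsLinear ⟦_⟧

  open LeftModuleMorphisms.IsLeftModuleHomomorphism isLinear public
    using (+ᴹ-homo; *ₗ-homo)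

open LinearOperator public using (⟦_⟧; isLinear; +ᴹ-homo; *ₗ-homo)

mkIsLinear : {f : 𝔽₂^ m → 𝔽₂^ m} →
             (∀ x y → f (x ⊕ y) ≡ f x ⊕ f y) →
             (∀ a x → f (a ⊙ x) ≡ a ⊙ f x) →
             IsLinear f
mkIsLinear {f = f} +-homo *-homo = record
  { +ᴹ-isGroupHomomorphism = record
    { isMonoidHomomorphism = record
      { isMagmaHomomorphism = record
        { isRelHomomorphism = record { cong = cong f }
        ; homo = +-homo
        }
      ; ε-homo = begin
          f 𝟎          ≡⟨ cong f (⊙-zeroˡ 𝟎) ⟨
          f (0ℙ ⊙ 𝟎)  ≡⟨ *-homo 0ℙ 𝟎 ⟩
          0ℙ ⊙ f 𝟎    ≡⟨ ⊙-zeroˡ (f 𝟎) ⟩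
          𝟎            ∎
      }
    ; ⁻¹-homo = λ _ → refl
    }
  ; *ₗ-homo = *-homo
  }
  where open ≡-Reasoning

-- Equality of operators is pointwise, since function extensionality is
-- not available.
infix 4 _≈_

_≈_ : LinearOperator m → LinearOperator m → Set
F ≈ G = ∀ y → ⟦ F ⟧ y ≡ ⟦ G ⟧ y

_+ᴸ_ : LinearOperator m → LinearOperator m → LinearOperator m
F +ᴸ G = (λ y → ⟦ F ⟧ y ⊕ ⟦ G ⟧ y) , mkIsLinear
  (λ x y → trans (cong₂ _⊕_ (+ᴹ-homo F x y) (+ᴹ-homo G x y)) (⊕-interchange _ _ _ _))
  (λ a x → trans (cong₂ _⊕_ (*ₗ-homo F a x) (*ₗ-homo G a x)) (sym (⊙-distribˡ a _ _)))

_∘ᴸ_ : LinearOperator m → LinearOperator m → LinearOperator m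
F ∘ᴸ G = ⟦ F ⟧ ∘ ⟦ G ⟧ , Composition.isLeftModuleHomomorphism trans (isLinear G) (isLinear F)

0ᴸ : LinearOperator m
0ᴸ = (λ _ → 𝟎) , mkIsLinear (λ _ _ → sym (⊕-self 𝟎)) (λ a _ → sym (⊙-zeroʳ a))

idᴸ : LinearOperator m
idᴸ {m} = id , Identity.isLeftModuleHomomorphism _ refl

operators : ℕ → RawSemiring 0ℓ 0ℓ
operators m = record
  { Carrier = LinearOperator m
  ; _≈_ = _≈_
  ; _+_ = _+ᴸ_
  ; _*_ = _∘ᴸ_
  ; 0#  = 0ᴸ
  ; 1#  = idᴸ
  }

module _ {m : ℕ} where
  open RawSemiringDefinitions (operators m) public using (_^_; sum)

∑[_] : Subset m → (Fin m → LinearOperator m) → LinearOperator m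
∑[ T ] F = sum (λ t → if does (t ∈? T) then F t else 0ᴸ)

coordinate : 𝔽₂^ m → ∀ {j} → Dec (j < m) → Parity
coordinate y (yes j<m) = lookup y (fromℕ< j<m)
coordinate y (no  _)   = 0ℙ

-- The condition i < m − d is written i + d < m, which is also false for
-- every i when d ≥ m.
shift : ℕ → 𝔽₂^ m → 𝔽₂^ m
shift {m} d y = tabulate (λ i → coordinate y (toℕ i ℕ.+ d <? m))

coordinate-⊕ : (x y : 𝔽₂^ m) → ∀ {j} (j<?m : Dec (j < m)) →
               coordinate (x ⊕ y) j<?m ≡ coordinate x j<?m + coordinate y j<?m
coordinate-⊕ x y (yes j<m) = lookup-zipWith _+_ (fromℕ< j<m) x y
coordinate-⊕ x y (no  _)   = refl

coordinate-⊙ : (a : Parity) (x : 𝔽₂^ m) → ∀ {j} (j<?m : Dec (j < m)) →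
               coordinate (a ⊙ x) j<?m ≡ a * coordinate x j<?m
coordinate-⊙ a x (yes j<m) = lookup-map (fromℕ< j<m) (a *_) x
coordinate-⊙ a x (no  _)   = sym (ℙ.*-zeroʳ a)

tabulate-⊕ : ∀ {n} (f g : Fin n → Parity) →
             tabulate (λ i → f i + g i) ≡ tabulate f ⊕ tabulate g
tabulate-⊕ {ℕ.zero}  f g = refl
tabulate-⊕ {ℕ.suc n} f g = cong (f Fin.zero + g Fin.zero ∷_) (tabulate-⊕ (f ∘ Fin.suc) (g ∘ Fin.suc))

-- Nᵈ is defined directly for each d, not as an iterate of N.
N^ : ℕ → LinearOperator m
N^ {m} d = shift d , mkIsLinear
  (λ x y → trans (tabulate-cong (λ i → coordinate-⊕ x y (toℕ i ℕ.+ d <? m))) (tabulate-⊕ _ _))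
  (λ a x → trans (tabulate-cong (λ i → coordinate-⊙ a x (toℕ i ℕ.+ d <? m))) (tabulate-∘ (a *_) _))

Δ : Fin m → ℕ
Δ {m} t = m ∸ toℕ t

{-# OPTIONS --safe #-}

-- The shifts Nᵈ commute, since Nᵃ Nᵇ = Nᵃ⁺ᵇ, and in characteristic 2 squaring
-- is additive on commuting operators. Hence U^(2^(k+1)) = (∑ N^(2^k Δₜ))² =
-- ∑ N^(2 · 2^k Δₜ) by induction on k.

module Submission where

open import Defs
open import Algebra.Module.Morphism.Structures using (module LeftModuleMorphisms)
open import Data.Bool.Base using (Bool; true; false; if_then_else_)
open import Data.Fin.Base using (Fin; zero; suc; toℕ; fromℕ<)
open import Data.Fin.Properties using (toℕ-fromℕ<)
open import Data.Fin.Subset.Properties using (_∈?_)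
open import Data.Nat.Base as ℕ using (ℕ; _≥_; _*_; _<_)
import Data.Nat.Properties as ℕ
open import Data.Fin.Subset using (Subset)
open import Data.Parity.Base using (0ℙ)
import Data.Parity.Properties as ℙ
open import Data.Vec.Properties using (lookup∘tabulate; tabulate-cong; zipWith-identityˡ)
open import Function.Base using (_∘_)
open import Relation.Binary.PropositionalEquality
open import Relation.Nullary using (¬_; does; yes; no; contradiction)

-- Squaring acts as a Frobenius map on commuting operators over 𝔽₂: the cross terms of (F + G)² are
-- equal and cancel (`square-+`), and induction extends this to finite sums (`square-∑`). Truncated
-- shifts compose by adding their exponents (`N^-∘`), so they commute and squaring one doubles its
-- exponent. Each of k successive squarings of U therefore doubles every exponent in the sum.

private
  variable
    m n : ℕ

^-homo-∘ : (F : LinearOperator m) (a b : ℕ) → F ^ (a ℕ.+ b) ≈ (F ^ a) ∘ᴸ (F ^ b)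
^-homo-∘ F ℕ.zero    b y = refl
^-homo-∘ F (ℕ.suc a) b y = cong ⟦ F ⟧ (^-homo-∘ F a b y)

operator-𝟎 : (F : LinearOperator m) → ⟦ F ⟧ 𝟎 ≡ 𝟎
operator-𝟎 F = IsLeftModuleHomomorphism.0ᴹ-homo (isLinear F)
  where open LeftModuleMorphisms using (module IsLeftModuleHomomorphism)

sum-cong : {F G : Fin n → LinearOperator m} → (∀ t → F t ≈ G t) → sum F ≈ sum G
sum-cong {n = ℕ.zero}  F≈G y = refl
sum-cong {n = ℕ.suc n} F≈G y = cong₂ _⊕_ (F≈G zero y) (sum-cong (F≈G ∘ suc) y)

Commute : LinearOperator m → LinearOperator m → Set
Commute F G = F ∘ᴸ G ≈ G ∘ᴸ F

0ᴸ-commute : (F : LinearOperator m) → Commute 0ᴸ F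
0ᴸ-commute F y = sym (operator-𝟎 F)

-- Linearity of `F` lets it pass through the sum. This is what allows `square-sum` to split off one
-- term and apply `square-+` to it and the rest.
sum-commute : (F : LinearOperator m) {G : Fin n → LinearOperator m} →
              (∀ t → Commute F (G t)) → Commute F (sum G)
sum-commute {n = ℕ.zero}  F     FG y = operator-𝟎 F
sum-commute {n = ℕ.suc n} F {G} FG y = trans
  (+ᴹ-homo F (⟦ G zero ⟧ y) (⟦ sum (G ∘ suc) ⟧ y))
  (cong₂ _⊕_ (FG zero y) (sum-commute F (FG ∘ suc) y))

square-+ : (F G : LinearOperator m) → Commute F G →
           (F +ᴸ G) ∘ᴸ (F +ᴸ G) ≈ (F ∘ᴸ F) +ᴸ (G ∘ᴸ G)
square-+ F G FG y = begin
  f (f y ⊕ g y) ⊕ g (f y ⊕ g y)  ≡⟨ cong₂ _⊕_ (+ᴹ-homo F _ _) (+ᴹ-homo G _ _) ⟩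
  (ff ⊕ fg) ⊕ (gf ⊕ gg)          ≡⟨ cong (_⊕ (gf ⊕ gg)) (⊕-comm ff fg) ⟩
  (fg ⊕ ff) ⊕ (gf ⊕ gg)          ≡⟨ ⊕-interchange fg ff gf gg ⟩
  (fg ⊕ gf) ⊕ (ff ⊕ gg)          ≡⟨ cong (λ v → (v ⊕ gf) ⊕ (ff ⊕ gg)) (FG y) ⟩
  -- Characteristic 2 enters here: the two cross terms, now equal, add to zero.
  (gf ⊕ gf) ⊕ (ff ⊕ gg)          ≡⟨ cong (_⊕ (ff ⊕ gg)) (⊕-self gf) ⟩
  𝟎 ⊕ (ff ⊕ gg)                  ≡⟨ zipWith-identityˡ ℙ.+-identityˡ (ff ⊕ gg) ⟩
  ff ⊕ gg                        ∎
  where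
  open ≡-Reasoning
  f = ⟦ F ⟧
  g = ⟦ G ⟧
  ff = f (f y)
  fg = f (g y)
  gf = g (f y)
  gg = g (g y)

square-sum : (F : Fin n → LinearOperator m) → (∀ s t → Commute (F s) (F t)) →
             sum F ∘ᴸ sum F ≈ sum (λ t → F t ∘ᴸ F t)
square-sum {n = ℕ.zero}  F FF y = refl
square-sum {n = ℕ.suc n} F FF y = trans
  (square-+ (F zero) (sum (F ∘ suc)) (sum-commute (F zero) (FF zero ∘ suc)) y)
  (cong (_ ⊕_) (square-sum (F ∘ suc) (λ s t → FF (suc s) (suc t)) y))

∑-cong : (T : Subset m) {F G : Fin m → LinearOperator m} →
         (∀ t → F t ≈ G t) → ∑[ T ] F ≈ ∑[ T ] G
∑-cong T {F} {G} F≈G = sum-cong (λ t → if-cong (does (t ∈? T)) t)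
  where
  if-cong : ∀ b t → (if b then F t else 0ᴸ) ≈ (if b then G t else 0ᴸ)
  if-cong true  t = F≈G t
  if-cong false t = λ _ → refl

square-∑ : (T : Subset m) (F : Fin m → LinearOperator m) →
           (∀ s t → Commute (F s) (F t)) →
           ∑[ T ] F ∘ᴸ ∑[ T ] F ≈ ∑[ T ] (λ t → F t ∘ᴸ F t)
square-∑ {m} T F FF y = trans
  (square-sum _ (λ s t → if-commute (does (s ∈? T)) (does (t ∈? T)) s t) y)
  (sum-cong (λ t → if-square (does (t ∈? T)) t) y)
  where
  -- Membership in `T` matters only through its Boolean value, so it becomes a free argument to
  -- split on; terms outside `T` are zero.
  F? : Bool → Fin m → LinearOperator m
  F? b t = if b then F t else 0ᴸ

  if-commute : ∀ b c s t → Commute (F? b s) (F? c t)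
  if-commute false c     s t y = 0ᴸ-commute (F? c t) y
  if-commute true  false s t y = sym (0ᴸ-commute (F s) y)
  if-commute true  true  s t   = FF s t

  if-square : ∀ b t → F? b t ∘ᴸ F? b t ≈ (if b then F t ∘ᴸ F t else 0ᴸ)
  if-square true  t y = refl
  if-square false t y = refl

coordinate-≥ : (y : 𝔽₂^ m) {j : ℕ} → ¬ (j < m) → coordinate y (j ℕ.<? m) ≡ 0ℙ
coordinate-≥ {m} y {j} j≮m with j ℕ.<? m
... | yes j<m = contradiction j<m j≮m
... | no  _   = refl

-- Stated for every natural `j`, since `N^-∘` uses it at `toℕ i + a`, which may leave the range.
coordinate-shift : (b : ℕ) (y : 𝔽₂^ m) (j : ℕ) →
                   coordinate (shift b y) (j ℕ.<? m) ≡ coordinate y (j ℕ.+ b ℕ.<? m)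
coordinate-shift {m} b y j with j ℕ.<? m
... | yes j<m = trans
  (lookup∘tabulate _ (fromℕ< j<m))
  (cong (λ i → coordinate y (i ℕ.+ b ℕ.<? m)) (toℕ-fromℕ< j<m))
-- If `j` is out of range, so is `j + b`, and both sides are zero.
... | no  j≮m = sym (coordinate-≥ y (j≮m ∘ ℕ.m+n≤o⇒m≤o (ℕ.suc j)))

N^-∘ : (a b : ℕ) → N^ {m} a ∘ᴸ N^ b ≈ N^ (a ℕ.+ b)
N^-∘ {m} a b y = tabulate-cong λ i → trans
  (coordinate-shift b y (toℕ i ℕ.+ a))
  (cong (λ j → coordinate y (j ℕ.<? m)) (ℕ.+-assoc (toℕ i) a b))

N^-cong : {a b : ℕ} → a ≡ b → N^ {m} a ≈ N^ b
N^-cong refl y = refl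

N^-commute : (a b : ℕ) → Commute (N^ {m} a) (N^ b)
N^-commute a b y = begin
  shift a (shift b y)  ≡⟨ N^-∘ a b y ⟩
  shift (a ℕ.+ b) y    ≡⟨ N^-cong (ℕ.+-comm a b) y ⟩
  shift (b ℕ.+ a) y    ≡⟨ N^-∘ b a y ⟨
  shift b (shift a y)  ∎
  where open ≡-Reasoning

lemma3p2 : (m : ℕ) → m ≥ 1 → (T : Subset m) →
    let U = ∑[ T ] (λ t → N^ (Δ t)) in
    (k : ℕ) → U ^ (2 ℕ.^ k) ≈ ∑[ T ] (λ t → N^ (2 ℕ.^ k * Δ t))
-- `U ^ 1` computes to `U` at `y`, so only the factor 1 in the exponents is left.
lemma3p2 m m≥1 T ℕ.zero y = ∑-cong T (λ t → N^-cong (sym (ℕ.*-identityˡ (Δ t)))) y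
lemma3p2 m m≥1 T (ℕ.suc k) y = begin
  ⟦ U ^ (2 ℕ.* q) ⟧ y                    ≡⟨ cong (λ r → ⟦ U ^ (q ℕ.+ r) ⟧ y) (ℕ.+-identityʳ q) ⟩
  ⟦ U ^ (q ℕ.+ q) ⟧ y                    ≡⟨ ^-homo-∘ U q q y ⟩
  ⟦ U ^ q ⟧ (⟦ U ^ q ⟧ y)                ≡⟨ cong ⟦ U ^ q ⟧ (IH y) ⟩
  ⟦ U ^ q ⟧ (⟦ ∑[ T ] S ⟧ y)             ≡⟨ IH (⟦ ∑[ T ] S ⟧ y) ⟩
  ⟦ ∑[ T ] S ⟧ (⟦ ∑[ T ] S ⟧ y)          ≡⟨ square-∑ T S (λ s t → N^-commute (q * Δ s) (q * Δ t)) y ⟩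
  ⟦ ∑[ T ] (λ t → S t ∘ᴸ S t) ⟧ y        ≡⟨ ∑-cong T double y ⟩
  ⟦ ∑[ T ] (λ t → N^ (2 * q * Δ t)) ⟧ y  ∎
  where
  open ≡-Reasoning
  q = 2 ℕ.^ k
  U = ∑[ T ] (λ t → N^ (Δ t))

  S : Fin m → LinearOperator m
  S t = N^ (q * Δ t)

  IH : U ^ q ≈ ∑[ T ] S
  IH = lemma3p2 m m≥1 T k

  double : ∀ t → S t ∘ᴸ S t ≈ N^ (2 * q * Δ t)
  double t y = trans (N^-∘ (q * Δ t) (q * Δ t) y) (N^-cong (begin
    q * Δ t ℕ.+ q * Δ t  ≡⟨ cong (q * Δ t ℕ.+_) (ℕ.+-identityʳ (q * Δ t)) ⟨
    2 * (q * Δ t)        ≡⟨ ℕ.*-assoc 2 q (Δ t) ⟨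
    2 * q * Δ t          ∎) y)
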